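{- For every nonnegative integer $n$, $$a(n)+\sum_{\substack{k\ge 1\\ k+k^2\le n}} a(n-k-k^2)\equiv \Delta(n)\pmod 2,$$ where $\Delta(n)=1$ if $n=s(s+1)/2$ for some integer $s$, and $\Delta(n)=0$ otherwise.
   Context: Let $(q;q)_\infty=\prod_{n=1}^\infty(1-q^n)$ and $(q^2;q^2)_\infty=\prod_{n=1}^\infty(1-q^{2n})$. The number of cubic partitions $a(n)$ is defined for $n\ge 0$ by the generating function $\sum_{n=0}^\infty a(n)q^n=\frac{1}{(q;q)_\infty(q^2;q^2)_\infty}$; $a(m)$ for $m<0$ does not occur. -}

module Defs where

open import Data.Nat using (ℕ; zero; suc; _+_; _*_; _∸_; _≤_; _%_)
open import Data.Nat.Divisibility using (_∣?_)
open import Data.Bool using (if_then_else_)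
open import Relation.Nullary.Decidable using (does)
open import Data.Product using (∃-syntax; _×_)
open import Relation.Binary.PropositionalEquality using (_≡_)

Series : Set
Series = ℕ → ℕ

sumUpTo : ℕ → (ℕ → ℕ) → ℕ
sumUpTo zero    f = f 0
sumUpTo (suc n) f = sumUpTo n f + f (suc n)

_⊛_ : Series → Series → Series
(f ⊛ g) n = sumUpTo n (λ i → f i * g (n ∸ i))

one : Series
one zero    = 1
one (suc _) = 0

-- 1/(1 - q^k) = Σ_{j≥0} q^{jk}  (used for k ≥ 1): coefficient of q^m is 1 iff k ∣ m.
geom : ℕ → Series
geom k m = if does (k ∣? m) then 1 else 0

prodGeom : ℕ → ℕ → Series
prodGeom c zero    = one
prodGeom c (suc N) = prodGeom c N ⊛ geom (c * suc N)

-- a(n) = coefficient of q^n in 1/((q;q)_∞ (q^2;q^2)_∞).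
-- Factors 1/(1-q^m) with m > n do not affect the coefficient of q^n,
-- so truncating both products at k = n gives the exact coefficient.
a : ℕ → ℕ
a n = (prodGeom 1 n ⊛ prodGeom 2 n) n

-- Σ_{k ≥ 1, k + k^2 ≤ n} a(n - k - k^2)
-- (terms with k + k^2 > n are excluded; k ranges over 1..n which suffices)
sumTerm : ℕ → ℕ → ℕ
sumTerm n k = if does (Data.Nat._≤?_ (k + k * k) n) then a (n ∸ (k + k * k)) else 0

lhs : ℕ → ℕ
lhs n = a n + sumUpTo n (λ k → if does (Data.Nat._≟_ k 0) then 0 else sumTerm n k)

-- Δ(n) = 1 if n = s(s+1)/2 for some integer s, else 0.
-- (For integer s, s(s+1)/2 ranges over the same values as for s ∈ ℕ; we state
-- it as 2n = s(s+1) with s ∈ ℕ.)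
IsTriangular : ℕ → Set
IsTriangular n = ∃[ s ] (2 * n ≡ s * (s + 1))

{-# OPTIONS --safe #-}
module Submission where

open import Defs
open import Algebra using (CommutativeSemiring; CommutativeRing; Congruent₂)
open import Algebra.Structures.Biased using (isCommutativeMonoidˡ; isCommutativeSemiringˡ)
open import Data.Bool using (if_then_else_)
open import Data.Maybe using (just; nothing)
open import Data.Nat as ℕ
  using (ℕ; zero; suc; _∸_; _%_; _≤_; _<_; _≤′_; ≤′-refl; ≤′-step; parity)
open import Data.Nat.Divisibility using (_∣?_; _∣0; >⇒∤; ∣-refl; ∣m+n∣m⇒∣n; ∣m∣n⇒∣m+n)
import Data.Nat.Properties as ℕ
open import Data.Nat.Solver using (module +-*-Solver)
open import Data.Parity as ℙ using (Parity; 0ℙ; 1ℙ)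
import Data.Parity.Properties as ℙ
open import Data.Product using (_×_; _,_; ∃-syntax)
open import Data.Sum using (_⊎_; inj₁; inj₂)
open import Function using (_∘_; mk⇔)
open import Relation.Binary.PropositionalEquality as ≡ using (_≡_; _≢_; _≗_; cong; cong₂)
open import Relation.Binary.Definitions using (WeaklyDecidable)
open import Relation.Binary.Structures using (IsEquivalence)
open import Relation.Nullary using (¬_; Dec; yes; no; does; contradiction)
open import Relation.Nullary.Decidable using (dec-true; dec-false; does-⇔)

-- Let f_k = (q^k; q^k)_∞ and ψ = Σ_{s≥0} q^(s(s+1)/2). Everything happens in 𝔽₂[q]/(q^(N+1)),
-- where Σ a(n) q^n = 1/(f₁f₂) and, by Frobenius, ψ² = Σ q^(s+s²) and f₂ = f₁². Hence the
-- claim ψ²/(f₁f₂) = ψ reduces to ψ = f₁f₂. Shanks' finite form of Gauss's identity,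
--   Σ_{s<n} (q²;q²)_n/(q²;q²)_s (q;q²)_s q^(s(2n+1)) = (q;q²)_n Σ_{s<2n} q^(s(s+1)/2),
-- gives (q;q²)_∞ ψ = f₂; multiplying by f₂ yields f₁ψ = f₂² = f₁²f₂, and f₁ cancels.

-- Triangular numbers.

tri : ℕ → ℕ
tri zero    = 0
tri (suc k) = suc k ℕ.+ tri k

-- With y = q^(2n+1), this and the next lemma turn `y ^ n` and `y ^ suc n` into the terms of ψ of
-- index 2n and 2n+1.
tri-double : ∀ n → tri (n ℕ.* 2) ≡ suc (n ℕ.* 2) ℕ.* n
tri-double zero    = ≡.refl
tri-double (suc n) =
  ≡.trans (cong (λ t → suc (suc (n ℕ.* 2)) ℕ.+ (suc (n ℕ.* 2) ℕ.+ t)) (tri-double n))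
    (+-*-Solver.solve 1
      (λ n → (con 2 :+ n :* con 2) :+ ((con 1 :+ n :* con 2) :+ (con 1 :+ n :* con 2) :* n)
             := (con 3 :+ n :* con 2) :* (con 1 :+ n))
      ≡.refl n)
  where open +-*-Solver using (con; _:+_; _:*_; _:=_)

tri-suc-double : ∀ n → tri (suc (n ℕ.* 2)) ≡ suc (n ℕ.* 2) ℕ.* suc n
tri-suc-double n =
  ≡.trans (cong (suc (n ℕ.* 2) ℕ.+_) (tri-double n)) (≡.sym (ℕ.*-suc (suc (n ℕ.* 2)) n))

2*tri : ∀ s → 2 ℕ.* tri s ≡ s ℕ.* (s ℕ.+ 1)
2*tri zero    = ≡.refl
2*tri (suc s) =
  ≡.trans (ℕ.*-distribˡ-+ 2 (suc s) (tri s))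
    (≡.trans (cong (2 ℕ.* suc s ℕ.+_) (2*tri s))
      (+-*-Solver.solve 1
        (λ s → con 2 :* (con 1 :+ s) :+ s :* (s :+ con 1)
               := (con 1 :+ s) :* ((con 1 :+ s) :+ con 1))
        ≡.refl s))
  where open +-*-Solver using (con; _:+_; _:*_; _:=_)

n≤tri : ∀ n → n ≤ tri n
n≤tri zero    = ℕ.z≤n
n≤tri (suc n) = ℕ.m≤m+n (suc n) (tri n)

-- Commutative semirings of characteristic two.

module CharacteristicTwo {c ℓ} (R : CommutativeSemiring c ℓ)
  (x+x≈0 : ∀ x → CommutativeSemiring._≈_ R (CommutativeSemiring._+_ R x x)
                                           (CommutativeSemiring.0# R)) where

  open CommutativeSemiring R
  open import Algebra.Properties.CommutativeSemiring.Exp R public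
  open import Algebra.Solver.Ring.AlmostCommutativeRing
    using (fromCommutativeSemiring; Induced-equivalence; _-Raw-AlmostCommutative⟶_)
  open import Relation.Binary.Reasoning.Setoid setoid

  -- With coefficients in 𝔽₂ the ring solver cancels doubled terms, so `solve` proves identities
  -- that hold only in characteristic two. Negation is the identity on both sides.
  parityCoefficients : CommutativeRing.rawRing ℙ.+-*-commutativeRing
                         -Raw-AlmostCommutative⟶ fromCommutativeSemiring R
  parityCoefficients = record
    { ⟦_⟧    = ⟦_⟧
    ; +-homo = +-homo
    ; *-homo = *-homo
    ; -‿homo = λ _ → refl
    ; 0-homo = refl
    ; 1-homo = refl
    }
    where
    ⟦_⟧ : Parity → Carrier
    ⟦ 0ℙ ⟧ = 0#
    ⟦ 1ℙ ⟧ = 1#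

    +-homo : ∀ a b → ⟦ a ℙ.+ b ⟧ ≈ ⟦ a ⟧ + ⟦ b ⟧
    +-homo 0ℙ b  = sym (+-identityˡ ⟦ b ⟧)
    +-homo 1ℙ 0ℙ = sym (+-identityʳ 1#)
    +-homo 1ℙ 1ℙ = sym (x+x≈0 1#)

    *-homo : ∀ a b → ⟦ a ℙ.* b ⟧ ≈ ⟦ a ⟧ * ⟦ b ⟧
    *-homo 0ℙ b = sym (zeroˡ ⟦ b ⟧)
    *-homo 1ℙ b = sym (*-identityˡ ⟦ b ⟧)

  _coeff≟_ : WeaklyDecidable (Induced-equivalence parityCoefficients)
  0ℙ coeff≟ 0ℙ = just refl
  1ℙ coeff≟ 1ℙ = just refl
  _  coeff≟ _  = nothing

  open import Algebra.Solver.Ring (CommutativeRing.rawRing ℙ.+-*-commutativeRing)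
    (fromCommutativeSemiring R) parityCoefficients
    _coeff≟_
    using (solve; con; _:+_; _:*_; _:=_)

  ∑ : ℕ → (ℕ → Carrier) → Carrier
  ∑ zero    f = 0#
  ∑ (suc n) f = ∑ n f + f n

  ∑-cong : ∀ n {f g} → (∀ k → f k ≈ g k) → ∑ n f ≈ ∑ n g
  ∑-cong zero    f≈g = refl
  ∑-cong (suc n) f≈g = +-cong (∑-cong n f≈g) (f≈g n)

  -- Frobenius: every cross term occurs twice and vanishes.
  ∑-square : ∀ n f → ∑ n f * ∑ n f ≈ ∑ n (λ k → f k * f k)
  ∑-square zero    f = zeroˡ 0#
  ∑-square (suc n) f = begin
    (∑ n f + f n) * (∑ n f + f n)
      ≈⟨ solve 2 (λ s x → (s :+ x) :* (s :+ x) := s :* s :+ x :* x) refl (∑ n f) (f n) ⟩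
    ∑ n f * ∑ n f + f n * f n
      ≈⟨ +-congʳ (∑-square n f) ⟩
    ∑ n (λ k → f k * f k) + f n * f n ∎

  -- Finite q-products and Shanks' identity.

  module _ (q : Carrier) where

    -- Since -1 = 1, this is (q^c; q^c)_n.
    qProd : ℕ → ℕ → Carrier
    qProd c zero    = 1#
    qProd c (suc n) = qProd c n * (1# + q ^ (c ℕ.* suc n))

    oddProd : ℕ → Carrier
    oddProd zero    = 1#
    oddProd (suc n) = oddProd n * (1# + q ^ suc (n ℕ.* 2))

    ψ : ℕ → Carrier
    ψ n = ∑ n (λ s → q ^ tri s)

    q^2*suc : ∀ j → q ^ (2 ℕ.* suc j) ≈ q * (q * q ^ (j ℕ.* 2))
    q^2*suc j = ^-congʳ q (ℕ.*-comm 2 (suc j))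

    [q²y]^j : ∀ y j → (q * q * y) ^ j ≈ q ^ (j ℕ.* 2) * y ^ j
    [q²y]^j y zero    = sym (*-identityˡ 1#)
    [q²y]^j y (suc j) = begin
      q * q * y * (q * q * y) ^ j
        ≈⟨ *-congˡ ([q²y]^j y j) ⟩
      q * q * y * (q ^ (j ℕ.* 2) * y ^ j)
        ≈⟨ solve 4 (λ q y Q Y → q :* q :* y :* (Q :* Y) := q :* (q :* Q) :* (y :* Y))
             refl q y _ _ ⟩
      q * (q * q ^ (j ℕ.* 2)) * (y * y ^ j) ∎

    -- Σ_{s<j} (q²;q²)_j / (q²;q²)_s · (q;q²)_s · y^s, by Horner's rule.
    shanks : Carrier → ℕ → Carrier
    shanks y zero    = 0#
    shanks y (suc j) = (shanks y j + oddProd j * y ^ j) * (1# + q ^ (2 ℕ.* suc j))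

    -- Replacing y by q²y telescopes; at y = q^(2j+1) this is Shanks' induction step.
    shanks-shift : ∀ y j →
      (1# + q * y) * shanks (q * q * y) j
        ≈ (1# + y) * shanks y j + y ^ j * oddProd j * (1# + q ^ (j ℕ.* 2))
    shanks-shift y zero =
      solve 2 (λ q y → (con 1ℙ :+ q :* y) :* con 0ℙ
                       := (con 1ℙ :+ y) :* con 0ℙ
                          :+ con 1ℙ :* con 1ℙ :* (con 1ℙ :+ con 1ℙ)) refl q y
    shanks-shift y (suc j) = begin
      (1# + q * y) * ((S′ + D * (q * q * y) ^ j) * (1# + q ^ (2 ℕ.* suc j)))
        ≈⟨ *-congˡ (*-cong (+-congˡ (*-congˡ ([q²y]^j y j))) (+-congˡ (q^2*suc j))) ⟩
      (1# + q * y) * ((S′ + D * (Q * Y)) * (1# + q * (q * Q)))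
        ≈⟨ solve 6 (λ q y Q Y D S′ →
             (con 1ℙ :+ q :* y) :* ((S′ :+ D :* (Q :* Y)) :* (con 1ℙ :+ q :* (q :* Q)))
             := ((con 1ℙ :+ q :* y) :* S′ :+ (con 1ℙ :+ q :* y) :* (D :* (Q :* Y)))
                :* (con 1ℙ :+ q :* (q :* Q))) refl q y Q Y D S′ ⟩
      ((1# + q * y) * S′ + (1# + q * y) * (D * (Q * Y))) * (1# + q * (q * Q))
        ≈⟨ *-congʳ (+-congʳ (shanks-shift y j)) ⟩
      ((1# + y) * S + Y * D * (1# + Q) + (1# + q * y) * (D * (Q * Y)))
        * (1# + q * (q * Q))
        -- Apart from the factor 1 + q²Q, the two copies of DQY cancel on the left and the two
        -- copies of yYD on the right; both sides become (1 + y)S + DY + qyQYD.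
        ≈⟨ solve 6 (λ q y Q Y D S →
             ((con 1ℙ :+ y) :* S :+ Y :* D :* (con 1ℙ :+ Q)
               :+ (con 1ℙ :+ q :* y) :* (D :* (Q :* Y))) :* (con 1ℙ :+ q :* (q :* Q))
             := (con 1ℙ :+ y) :* ((S :+ D :* Y) :* (con 1ℙ :+ q :* (q :* Q)))
                :+ y :* Y :* (D :* (con 1ℙ :+ q :* Q)) :* (con 1ℙ :+ q :* (q :* Q)))
             refl q y Q Y D S ⟩
      (1# + y) * ((S + D * Y) * (1# + q * (q * Q)))
        + y * Y * (D * (1# + q * Q)) * (1# + q * (q * Q))
        ≈⟨ +-congʳ (*-congˡ (*-congˡ (+-congˡ (q^2*suc j)))) ⟨
      (1# + y) * ((S + D * Y) * (1# + q ^ (2 ℕ.* suc j)))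
        + y * Y * (D * (1# + q * Q)) * (1# + q * (q * Q)) ∎
      where
      S  = shanks y j
      S′ = shanks (q * q * y) j
      D  = oddProd j
      Q  = q ^ (j ℕ.* 2)
      Y  = y ^ j

    shanks-congˡ : ∀ {y z} → y ≈ z → ∀ j → shanks y j ≈ shanks z j
    shanks-congˡ y≈z zero    = refl
    shanks-congˡ y≈z (suc j) =
      *-congʳ (+-cong (shanks-congˡ y≈z j) (*-congˡ (^-congˡ j y≈z)))

    -- Induction on n: passing to n + 1 multiplies y = q^(2n+1) by q², so the shift relation leads
    -- back to the hypothesis. What it leaves over supplies the odd factor 1 + y and the next two
    -- terms of ψ.
    shanks-identity : ∀ n → shanks (q ^ suc (n ℕ.* 2)) n ≈ oddProd n * ψ (n ℕ.* 2)
    shanks-identity zero    = sym (zeroʳ 1#)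
    shanks-identity (suc n) = begin
      (shanks (q * (q * y)) n + D * (q * (q * y)) ^ n) * (1# + q ^ (2 ℕ.* suc n))
        ≈⟨ *-cong (+-cong (shanks-congˡ q[qy]≈qqy n)
                          (*-congˡ (trans (^-congˡ n q[qy]≈qqy) ([q²y]^j y n))))
                  (+-congˡ (q^2*suc n)) ⟩
      (S′ + D * (Q * Y)) * (1# + q * (q * Q))
        ≈⟨ solve 5 (λ q Q Y D S′ →
             (S′ :+ D :* (Q :* Y)) :* (con 1ℙ :+ q :* (q :* Q))
             := (con 1ℙ :+ q :* (q :* Q)) :* S′
                :+ D :* (Q :* Y) :* (con 1ℙ :+ q :* (q :* Q))) refl q Q Y D S′ ⟩
      (1# + q * y) * S′ + D * (Q * Y) * (1# + q * y)
        -- Because y = q^(2n+1), the new even factor 1 + q^(2n+2) is 1 + qy, exactly the multiplier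
        -- in the shift relation.
        ≈⟨ +-congʳ (shanks-shift y n) ⟩
      (1# + y) * S + Y * D * (1# + Q) + D * (Q * Y) * (1# + q * y)
        ≈⟨ +-congʳ (+-congʳ (*-congˡ (shanks-identity n))) ⟩
      (1# + y) * (D * T) + Y * D * (1# + Q) + D * (Q * Y) * (1# + q * y)
        -- The two copies of DQY cancel, and Y + y²Y = (1 + y)²Y, so D(1 + y) factors out.
        ≈⟨ solve 5 (λ q Q Y D T →
             (con 1ℙ :+ q :* Q) :* (D :* T) :+ Y :* D :* (con 1ℙ :+ Q)
               :+ D :* (Q :* Y) :* (con 1ℙ :+ q :* (q :* Q))
             := D :* (con 1ℙ :+ q :* Q) :* (T :+ Y :+ q :* Q :* Y))
             refl q Q Y D T ⟩
      D * (1# + y) * (T + Y + y ^ suc n)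
        ≈⟨ *-congˡ (+-cong (+-congˡ (^-assocʳ q (suc (n ℕ.* 2)) n))
                           (^-assocʳ q (suc (n ℕ.* 2)) (suc n))) ⟩
      D * (1# + y) * (T + q ^ (suc (n ℕ.* 2) ℕ.* n) + q ^ (suc (n ℕ.* 2) ℕ.* suc n))
        ≈⟨ *-congˡ (+-cong (+-congˡ (^-congʳ q (tri-double n)))
                           (^-congʳ q (tri-suc-double n))) ⟨
      D * (1# + y) * (T + q ^ tri (n ℕ.* 2) + q ^ tri (suc (n ℕ.* 2))) ∎
      where
      Q  = q ^ (n ℕ.* 2)
      y  = q * Q
      S  = shanks y n
      S′ = shanks (q * q * y) n
      D  = oddProd n
      Y  = y ^ n
      T  = ψ (n ℕ.* 2)
      q[qy]≈qqy = sym (*-assoc q q y)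

    -- At y = 0 only the summand s = 0 survives, and it equals (q²;q²)_j. The sum must be nonempty,
    -- hence the index `suc j`.
    shanks-0 : ∀ {y} → y ≈ 0# → ∀ j → shanks y (suc j) ≈ qProd 2 (suc j)
    shanks-0     y≈0 zero    = *-congʳ (trans (+-identityˡ _) (*-identityˡ 1#))
    shanks-0 {y} y≈0 (suc j) = *-congʳ (begin
      shanks y (suc j) + oddProd (suc j) * (y * y ^ j)
        ≈⟨ +-cong (shanks-0 y≈0 j) (*-congˡ (*-congʳ y≈0)) ⟩
      qProd 2 (suc j) + oddProd (suc j) * (0# * y ^ j)
        ≈⟨ solve 3 (λ e d y → e :+ d :* (con 0ℙ :* y) := e)
             refl (qProd 2 (suc j)) (oddProd (suc j)) (y ^ j) ⟩
      qProd 2 (suc j) ∎)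

    oddProd*evenProd : ∀ n → oddProd n * qProd 2 n ≈ qProd 1 (n ℕ.* 2)
    oddProd*evenProd zero    = *-identityˡ 1#
    oddProd*evenProd (suc n) = begin
      oddProd n * (1# + q ^ suc (n ℕ.* 2)) * (qProd 2 n * (1# + q ^ (2 ℕ.* suc n)))
        ≈⟨ solve 4 (λ d x e y → d :* x :* (e :* y) := d :* e :* x :* y) refl _ _ _ _ ⟩
      oddProd n * qProd 2 n * (1# + q ^ suc (n ℕ.* 2)) * (1# + q ^ (2 ℕ.* suc n))
        ≈⟨ *-cong (*-cong (oddProd*evenProd n)
                          (+-congˡ (^-congʳ q (≡.sym (ℕ.*-identityˡ (suc (n ℕ.* 2)))))))
                  (+-congˡ (^-congʳ q (≡.trans (ℕ.*-comm 2 (suc n))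
                                               (≡.sym (ℕ.*-identityˡ (suc n ℕ.* 2)))))) ⟩
      qProd 1 (suc n ℕ.* 2) ∎

    -- Frobenius factor by factor: 1 + x² = (1 + x)².
    evenProd≈square : ∀ n → qProd 2 n ≈ qProd 1 n * qProd 1 n
    evenProd≈square zero    = sym (*-identityˡ 1#)
    evenProd≈square (suc n) = begin
      qProd 2 n * (1# + q ^ (2 ℕ.* suc n))
        ≈⟨ *-cong (evenProd≈square n) (+-congˡ q^2m≈[q^m]²) ⟩
      qProd 1 n * qProd 1 n * (1# + q ^ m * q ^ m)
        ≈⟨ solve 2 (λ f x → f :* f :* (con 1ℙ :+ x :* x)
                            := f :* (con 1ℙ :+ x) :* (f :* (con 1ℙ :+ x)))
             refl (qProd 1 n) (q ^ m) ⟩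
      qProd 1 (suc n) * qProd 1 (suc n) ∎
      where
      m = 1 ℕ.* suc n

      q^2m≈[q^m]² : q ^ (2 ℕ.* suc n) ≈ q ^ m * q ^ m
      q^2m≈[q^m]² = trans (^-congʳ q (≡.trans (ℕ.*-distribʳ-+ (suc n) 1 1) ≡.refl))
                          (^-homo-* q m m)

    -- Squaring a sum doubles its exponents, and twice a triangular number is s + s².
    ψ-square : ∀ n → ψ n * ψ n ≈ ∑ n (λ s → q ^ (s ℕ.+ s ℕ.* s))
    ψ-square n = trans (∑-square n (λ s → q ^ tri s)) (∑-cong n λ s → begin
      q ^ tri s * q ^ tri s    ≈⟨ ^-homo-* q (tri s) (tri s) ⟨
      q ^ (tri s ℕ.+ tri s)    ≈⟨ ^-congʳ q (tri+tri s) ⟩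
      q ^ (s ℕ.+ s ℕ.* s)      ∎)
      where
      tri+tri : ∀ s → tri s ℕ.+ tri s ≡ s ℕ.+ s ℕ.* s
      tri+tri s = ≡.trans (cong (tri s ℕ.+_) (≡.sym (ℕ.+-identityʳ (tri s))))
                    (≡.trans (2*tri s)
                      (≡.trans (cong (s ℕ.*_) (ℕ.+-comm s 1)) (ℕ.*-suc s s)))

    -- Truncation: powers of q beyond N vanish, so products and sums stabilise.

    module Truncated (N : ℕ) (q^≈0 : ∀ {k} → N < k → q ^ k ≈ 0#) where

      eventually-constant : ∀ {m} (f : ℕ → Carrier) →
        (∀ k → m ≤ k → f (suc k) ≈ f k) → ∀ {n} → m ≤′ n → f n ≈ f m
      eventually-constant f step ≤′-refl       = refl
      eventually-constant f step (≤′-step m≤n) =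
        trans (step _ (ℕ.≤′⇒≤ m≤n)) (eventually-constant f step m≤n)

      qProd-stable : ∀ c .{{_ : ℕ.NonZero c}} {n} → N ≤ n → qProd c n ≈ qProd c N
      qProd-stable c N≤n = eventually-constant (qProd c) step (ℕ.≤⇒≤′ N≤n)
        where
        step : ∀ k → N ≤ k → qProd c (suc k) ≈ qProd c k
        step k N≤k = begin
          qProd c k * (1# + q ^ (c ℕ.* suc k))
            ≈⟨ *-congˡ (+-congˡ (q^≈0 (ℕ.≤-trans (ℕ.s≤s N≤k) (ℕ.m≤n*m (suc k) c)))) ⟩
          qProd c k * (1# + 0#)
            ≈⟨ solve 1 (λ x → x :* (con 1ℙ :+ con 0ℙ) := x) refl (qProd c k) ⟩
          qProd c k ∎

      -- Terms with s > N vanish since s ≤ `tri s`. The bound `suc N` keeps the term s = N, which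
      -- can survive when N ≤ 1.
      ψ-stable : ∀ {n} → N < n → ψ n ≈ ψ (suc N)
      ψ-stable N<n = eventually-constant ψ step (ℕ.≤⇒≤′ N<n)
        where
        step : ∀ k → N < k → ψ (suc k) ≈ ψ k
        step k N<k = trans (+-congˡ (q^≈0 (ℕ.≤-trans N<k (n≤tri k)))) (+-identityʳ (ψ k))

      -- As A inverts f₁f₂, the product f₂A inverts f₁. Multiplying f₁ψ = f₂² = f₁²f₂ by it isolates
      -- ψ.
      ψ-product : ∀ {A} → qProd 1 N * qProd 2 N * A ≈ 1# →
                  ψ (suc N) ≈ qProd 1 N * qProd 2 N
      ψ-product {A} FEA≈1 = begin
        T                    ≈⟨ *-identityˡ T ⟨
        1# * T               ≈⟨ *-congʳ FEA≈1 ⟨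
        F * E * A * T        ≈⟨ solve 4 (λ F E A T → F :* E :* A :* T := E :* A :* (F :* T))
                                  refl F E A T ⟩
        E * A * (F * T)      ≈⟨ *-congˡ FT≈EE ⟩
        E * A * (E * E)      ≈⟨ *-congˡ (*-congʳ (evenProd≈square N)) ⟩
        E * A * (F * F * E)  ≈⟨ solve 3 (λ F E A → E :* A :* (F :* F :* E)
                                                    := F :* E :* A :* (F :* E)) refl F E A ⟩
        F * E * A * (F * E)  ≈⟨ *-congʳ FEA≈1 ⟩
        1# * (F * E)         ≈⟨ *-identityˡ (F * E) ⟩
        F * E                ∎
        where
        F = qProd 1 N
        E = qProd 2 N
        T = ψ (suc N)
        -- This n is positive, as `shanks-0` requires, and large enough that q^(2n+1) vanishes and
        -- all products and sums have stabilised.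
        n = suc N
        N<2n : N < n ℕ.* 2
        N<2n = ℕ.m≤m*n n 2

        E≈ : qProd 2 n ≈ E
        E≈ = qProd-stable 2 (ℕ.n≤1+n N)

        FT≈EE : F * T ≈ E * E
        FT≈EE = begin
          F * T
            ≈⟨ *-cong (qProd-stable 1 (ℕ.<⇒≤ N<2n)) (ψ-stable N<2n) ⟨
          qProd 1 (n ℕ.* 2) * ψ (n ℕ.* 2)
            ≈⟨ *-congʳ (oddProd*evenProd n) ⟨
          oddProd n * qProd 2 n * ψ (n ℕ.* 2)
            ≈⟨ solve 3 (λ d e t → d :* e :* t := d :* t :* e) refl _ _ _ ⟩
          oddProd n * ψ (n ℕ.* 2) * qProd 2 n
            ≈⟨ *-congʳ (shanks-identity n) ⟨
          shanks (q ^ suc (n ℕ.* 2)) n * qProd 2 n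
            -- Here 2n + 1 > N makes the argument of `shanks` zero.
            ≈⟨ *-cong (shanks-0 (q^≈0 (ℕ.m≤n⇒m≤1+n N<2n)) N) refl ⟩
          qProd 2 n * qProd 2 n
            ≈⟨ *-cong E≈ E≈ ⟩
          E * E ∎

      -- One factor of ψ² cancels against A: ψ²A = ψ(ψA) = ψ(f₁f₂A) = ψ.
      ψ-identity : ∀ {A} → qProd 1 N * qProd 2 N * A ≈ 1# →
                   ∑ (suc N) (λ s → q ^ (s ℕ.+ s ℕ.* s)) * A ≈ ψ (suc N)
      ψ-identity {A} FEA≈1 = begin
        ∑ (suc N) (λ s → q ^ (s ℕ.+ s ℕ.* s)) * A  ≈⟨ *-congʳ (ψ-square (suc N)) ⟨
        T * T * A                                  ≈⟨ *-assoc T T A ⟩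
        T * (T * A)                                ≈⟨ *-congˡ (*-congʳ (ψ-product FEA≈1)) ⟩
        T * (qProd 1 N * qProd 2 N * A)            ≈⟨ *-congˡ FEA≈1 ⟩
        T * 1#                                     ≈⟨ *-identityʳ T ⟩
        T                                          ∎
        where T = ψ (suc N)

      *-inverse : ∀ {x y x′ y′} → x * x′ ≈ 1# → y * y′ ≈ 1# → x * y * (x′ * y′) ≈ 1#
      *-inverse {x} {y} {x′} {y′} xx′≈1 yy′≈1 =
        trans (interchange x y x′ y′) (trans (*-cong xx′≈1 yy′≈1) (*-identityˡ 1#))
        where open import Algebra.Properties.CommutativeSemigroup *-commutativeSemigroup

      -- Geometric series and the generating function of cubic partitions.

      module Geometric
        (geom : ℕ → Carrier)
        (geom≈ : ∀ k .{{_ : ℕ.NonZero k}} → geom k ≈ 1# + q ^ k * geom k)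
        (prodGeom : ℕ → ℕ → Carrier)
        (prodGeom-zero : ∀ c → prodGeom c 0 ≈ 1#)
        (prodGeom-suc : ∀ c n → prodGeom c (suc n) ≈ prodGeom c n * geom (c ℕ.* suc n))
        where

        geom-inverse : ∀ k .{{_ : ℕ.NonZero k}} → (1# + q ^ k) * geom k ≈ 1#
        geom-inverse k = begin
          (1# + q ^ k) * geom k                        ≈⟨ distribʳ (geom k) 1# (q ^ k) ⟩
          1# * geom k + q ^ k * geom k                 ≈⟨ +-congʳ (*-identityˡ (geom k)) ⟩
          geom k + q ^ k * geom k                      ≈⟨ +-congʳ (geom≈ k) ⟩
          1# + q ^ k * geom k + q ^ k * geom k         ≈⟨ +-assoc 1# _ _ ⟩
          1# + (q ^ k * geom k + q ^ k * geom k)       ≈⟨ +-congˡ (x+x≈0 _) ⟩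
          1# + 0#                                      ≈⟨ +-identityʳ 1# ⟩
          1#                                           ∎

        prodGeom-inverse : ∀ c .{{_ : ℕ.NonZero c}} n → qProd c n * prodGeom c n ≈ 1#
        prodGeom-inverse c zero    = trans (*-identityˡ _) (prodGeom-zero c)
        prodGeom-inverse c (suc n) = trans (*-congˡ (prodGeom-suc c n))
          (*-inverse (prodGeom-inverse c n) (geom-inverse (c ℕ.* suc n) {{ℕ.m*n≢0 c (suc n)}}))

        -- A geometric series with step m > N is 1, by its recurrence and q^m = 0.
        prodGeom-stable : ∀ c .{{_ : ℕ.NonZero c}} {n} → N ≤ n → prodGeom c n ≈ prodGeom c N
        prodGeom-stable c N≤n = eventually-constant (prodGeom c) step (ℕ.≤⇒≤′ N≤n)
          where
          step : ∀ k → N ≤ k → prodGeom c (suc k) ≈ prodGeom c k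
          step k N≤k = begin
            prodGeom c (suc k)                     ≈⟨ prodGeom-suc c k ⟩
            prodGeom c k * geom m                  ≈⟨ *-congˡ (geom≈ m {{ℕ.m*n≢0 c (suc k)}}) ⟩
            prodGeom c k * (1# + q ^ m * geom m)   ≈⟨ *-congˡ (+-congˡ (*-congʳ (q^≈0 N<m))) ⟩
            prodGeom c k * (1# + 0# * geom m)      ≈⟨ *-congˡ (+-congˡ (zeroˡ (geom m))) ⟩
            prodGeom c k * (1# + 0#)               ≈⟨ *-congˡ (+-identityʳ 1#) ⟩
            prodGeom c k * 1#                      ≈⟨ *-identityʳ _ ⟩
            prodGeom c k                           ∎
            where
            m = c ℕ.* suc k
            N<m : N < m
            N<m = ℕ.≤-trans (ℕ.s≤s N≤k) (ℕ.m≤n*m (suc k) c)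

        cubic : ℕ → Carrier
        cubic n = prodGeom 1 n * prodGeom 2 n

        cubic-stable : ∀ {n} → N ≤ n → cubic n ≈ cubic N
        cubic-stable N≤n = *-cong (prodGeom-stable 1 N≤n) (prodGeom-stable 2 N≤n)

        cubic-convolution : ∑ (suc N) (λ s → q ^ (s ℕ.+ s ℕ.* s)) * cubic N ≈ ψ (suc N)
        cubic-convolution =
          ψ-identity (*-inverse (prodGeom-inverse 1 N) (prodGeom-inverse 2 N))

-- Formal power series under the Cauchy product.

infixl 6 _⊕_

_⊕_ : Series → Series → Series
(f ⊕ g) n = f n ℕ.+ g n

𝟘 : Series
𝟘 _ = 0

shift : Series → Series
shift f zero    = 0
shift f (suc n) = f n

-- mono k is q^k.
mono : ℕ → Series
mono zero    = one
mono (suc k) = shift (mono k)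

-- Stated for a general relation so as to serve both equality and equality of parities.
sumUpTo-preserves : (_~_ : ℕ → ℕ → Set) →
  (∀ {a b c d} → a ~ b → c ~ d → (a ℕ.+ c) ~ (b ℕ.+ d)) →
  ∀ n {f g} → (∀ i → i ≤ n → f i ~ g i) → sumUpTo n f ~ sumUpTo n g
sumUpTo-preserves _~_ +-pres zero    f~g = f~g 0 ℕ.z≤n
sumUpTo-preserves _~_ +-pres (suc n) f~g =
  +-pres (sumUpTo-preserves _~_ +-pres n (λ i i≤n → f~g i (ℕ.m≤n⇒m≤1+n i≤n)))
         (f~g (suc n) ℕ.≤-refl)

sumUpTo-cong : ∀ n {f g} → (∀ i → i ≤ n → f i ≡ g i) → sumUpTo n f ≡ sumUpTo n g
sumUpTo-cong = sumUpTo-preserves _≡_ (cong₂ ℕ._+_)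

sumUpTo-+ : ∀ n f g → sumUpTo n (f ⊕ g) ≡ sumUpTo n f ℕ.+ sumUpTo n g
sumUpTo-+ zero    f g = ≡.refl
sumUpTo-+ (suc n) f g =
  ≡.trans (cong (ℕ._+ (f (suc n) ℕ.+ g (suc n))) (sumUpTo-+ n f g))
          (interchange (sumUpTo n f) (sumUpTo n g) (f (suc n)) (g (suc n)))
  where open import Algebra.Properties.CommutativeSemigroup ℕ.+-commutativeSemigroup

sumUpTo-* : ∀ n c f → sumUpTo n (λ i → c ℕ.* f i) ≡ c ℕ.* sumUpTo n f
sumUpTo-* zero    c f = ≡.refl
sumUpTo-* (suc n) c f =
  ≡.trans (cong (ℕ._+ c ℕ.* f (suc n)) (sumUpTo-* n c f))
          (≡.sym (ℕ.*-distribˡ-+ c (sumUpTo n f) (f (suc n))))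

sumUpTo-suc : ∀ n f → sumUpTo (suc n) f ≡ f 0 ℕ.+ sumUpTo n (f ∘ suc)
sumUpTo-suc zero    f = ≡.refl
sumUpTo-suc (suc n) f =
  ≡.trans (cong (ℕ._+ f (suc (suc n))) (sumUpTo-suc n f)) (ℕ.+-assoc (f 0) _ _)

sumUpTo-0 : ∀ n → sumUpTo n 𝟘 ≡ 0
sumUpTo-0 zero    = ≡.refl
sumUpTo-0 (suc n) = cong (ℕ._+ 0) (sumUpTo-0 n)

⊛-congˡ : ∀ {f g} h → f ≗ g → (f ⊛ h) ≗ (g ⊛ h)
⊛-congˡ h f≗g n = sumUpTo-cong n (λ i _ → cong (ℕ._* h (n ∸ i)) (f≗g i))

⊛-sucˡ : ∀ f g n → (f ⊛ g) (suc n) ≡ f 0 ℕ.* g (suc n) ℕ.+ ((f ∘ suc) ⊛ g) n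
⊛-sucˡ f g n = sumUpTo-suc n (λ i → f i ℕ.* g (suc n ∸ i))

⊛-sucʳ : ∀ f g n → (f ⊛ g) (suc n) ≡ (f ⊛ (g ∘ suc)) n ℕ.+ f (suc n) ℕ.* g 0
⊛-sucʳ f g n = cong₂ ℕ._+_
  (sumUpTo-cong n (λ i i≤n → cong (λ j → f i ℕ.* g j) (ℕ.+-∸-assoc 1 i≤n)))
  (cong (λ j → f (suc n) ℕ.* g j) (ℕ.n∸n≡0 n))

-- Induction on the degree: the first summand of one product is the last summand of the other.
⊛-comm : ∀ f g → (f ⊛ g) ≗ (g ⊛ f)
⊛-comm f g zero    = ℕ.*-comm (f 0) (g 0)
⊛-comm f g (suc n) = begin
  (f ⊛ g) (suc n)                             ≡⟨ ⊛-sucˡ f g n ⟩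
  f 0 ℕ.* g (suc n) ℕ.+ ((f ∘ suc) ⊛ g) n     ≡⟨ ℕ.+-comm (f 0 ℕ.* g (suc n)) _ ⟩
  ((f ∘ suc) ⊛ g) n ℕ.+ f 0 ℕ.* g (suc n)     ≡⟨ cong₂ ℕ._+_ (⊛-comm (f ∘ suc) g n)
                                                             (ℕ.*-comm (f 0) (g (suc n))) ⟩
  (g ⊛ (f ∘ suc)) n ℕ.+ g (suc n) ℕ.* f 0     ≡⟨ ⊛-sucʳ g f n ⟨
  (g ⊛ f) (suc n)                             ∎
  where open ≡.≡-Reasoning

⊛-distribʳ : ∀ h f g → ((f ⊕ g) ⊛ h) ≗ ((f ⊛ h) ⊕ (g ⊛ h))
⊛-distribʳ h f g n =
  ≡.trans (sumUpTo-cong n (λ i _ → ℕ.*-distribʳ-+ (h (n ∸ i)) (f i) (g i)))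
          (sumUpTo-+ n (λ i → f i ℕ.* h (n ∸ i)) (λ i → g i ℕ.* h (n ∸ i)))

⊛-scale : ∀ c f g n → ((λ i → c ℕ.* f i) ⊛ g) n ≡ c ℕ.* (f ⊛ g) n
⊛-scale c f g n =
  ≡.trans (sumUpTo-cong n (λ i _ → ℕ.*-assoc c (f i) (g (n ∸ i))))
          (sumUpTo-* n c (λ i → f i ℕ.* g (n ∸ i)))

-- Induction on the degree, writing f = f(0) + q f′: the constant part is handled by scaling, and f′
-- enters in one degree lower.
⊛-assoc : ∀ f g h → ((f ⊛ g) ⊛ h) ≗ (f ⊛ (g ⊛ h))
⊛-assoc f g h zero    = ℕ.*-assoc (f 0) (g 0) (h 0)
⊛-assoc f g h (suc n) = begin
  ((f ⊛ g) ⊛ h) (suc n)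
    ≡⟨ ⊛-sucˡ (f ⊛ g) h n ⟩
  f 0 ℕ.* g 0 ℕ.* h (suc n) ℕ.+ (((f ⊛ g) ∘ suc) ⊛ h) n
    ≡⟨ cong₂ ℕ._+_ (ℕ.*-assoc (f 0) (g 0) (h (suc n))) tail ⟩
  f 0 ℕ.* (g 0 ℕ.* h (suc n)) ℕ.+ (f 0 ℕ.* ((g ∘ suc) ⊛ h) n ℕ.+ (f′ ⊛ (g ⊛ h)) n)
    ≡⟨ ℕ.+-assoc (f 0 ℕ.* (g 0 ℕ.* h (suc n))) _ _ ⟨
  f 0 ℕ.* (g 0 ℕ.* h (suc n)) ℕ.+ f 0 ℕ.* ((g ∘ suc) ⊛ h) n ℕ.+ (f′ ⊛ (g ⊛ h)) n
    ≡⟨ cong (ℕ._+ (f′ ⊛ (g ⊛ h)) n) (ℕ.*-distribˡ-+ (f 0) (g 0 ℕ.* h (suc n)) _) ⟨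
  f 0 ℕ.* (g 0 ℕ.* h (suc n) ℕ.+ ((g ∘ suc) ⊛ h) n) ℕ.+ (f′ ⊛ (g ⊛ h)) n
    ≡⟨ cong (λ x → f 0 ℕ.* x ℕ.+ (f′ ⊛ (g ⊛ h)) n) (⊛-sucˡ g h n) ⟨
  f 0 ℕ.* (g ⊛ h) (suc n) ℕ.+ (f′ ⊛ (g ⊛ h)) n
    ≡⟨ ⊛-sucˡ f (g ⊛ h) n ⟨
  (f ⊛ (g ⊛ h)) (suc n) ∎
  where
  open ≡.≡-Reasoning
  f′ = f ∘ suc
  tail : (((f ⊛ g) ∘ suc) ⊛ h) n ≡ f 0 ℕ.* ((g ∘ suc) ⊛ h) n ℕ.+ (f′ ⊛ (g ⊛ h)) n
  tail = begin
    (((f ⊛ g) ∘ suc) ⊛ h) n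
      ≡⟨ ⊛-congˡ h (⊛-sucˡ f g) n ⟩
    (((λ i → f 0 ℕ.* g (suc i)) ⊕ (f′ ⊛ g)) ⊛ h) n
      ≡⟨ ⊛-distribʳ h (λ i → f 0 ℕ.* g (suc i)) (f′ ⊛ g) n ⟩
    ((λ i → f 0 ℕ.* g (suc i)) ⊛ h) n ℕ.+ ((f′ ⊛ g) ⊛ h) n
      ≡⟨ cong₂ ℕ._+_ (⊛-scale (f 0) (g ∘ suc) h n) (⊛-assoc f′ g h n) ⟩
    f 0 ℕ.* ((g ∘ suc) ⊛ h) n ℕ.+ (f′ ⊛ (g ⊛ h)) n ∎

⊛-zeroˡ : ∀ f → (𝟘 ⊛ f) ≗ 𝟘
⊛-zeroˡ f = sumUpTo-0

⊛-identityˡ : ∀ f → (one ⊛ f) ≗ f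
⊛-identityˡ f zero    = ℕ.*-identityˡ (f 0)
⊛-identityˡ f (suc n) = begin
  (one ⊛ f) (suc n)                        ≡⟨ ⊛-sucˡ one f n ⟩
  1 ℕ.* f (suc n) ℕ.+ (𝟘 ⊛ f) n            ≡⟨ cong₂ ℕ._+_ (ℕ.*-identityˡ _) (⊛-zeroˡ f n) ⟩
  f (suc n) ℕ.+ 0                          ≡⟨ ℕ.+-identityʳ _ ⟩
  f (suc n)                                ∎
  where open ≡.≡-Reasoning

-- Multiplication by powers of q.

shift-⊛ : ∀ f g → (shift f ⊛ g) ≗ shift (f ⊛ g)
shift-⊛ f g zero    = ≡.refl
shift-⊛ f g (suc n) = ⊛-sucˡ (shift f) g n

mono-⊛-< : ∀ {k m} f → m < k → (mono k ⊛ f) m ≡ 0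
mono-⊛-< {suc k} {zero}  f _           = ≡.refl
mono-⊛-< {suc k} {suc m} f (ℕ.s≤s m<k) =
  ≡.trans (shift-⊛ (mono k) f (suc m)) (mono-⊛-< f m<k)

mono-⊛-+ : ∀ k f m → (mono k ⊛ f) (k ℕ.+ m) ≡ f m
mono-⊛-+ zero    f m = ⊛-identityˡ f m
mono-⊛-+ (suc k) f m = ≡.trans (shift-⊛ (mono k) f (suc (k ℕ.+ m))) (mono-⊛-+ k f m)

mono-≡ : ∀ k → mono k k ≡ 1
mono-≡ zero    = ≡.refl
mono-≡ (suc k) = mono-≡ k

mono-≢ : ∀ {k m} → k ≢ m → mono k m ≡ 0
mono-≢ {zero}  {zero}  k≢m = contradiction ≡.refl k≢m
mono-≢ {zero}  {suc m} k≢m = ≡.refl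
mono-≢ {suc k} {zero}  k≢m = ≡.refl
mono-≢ {suc k} {suc m} k≢m = mono-≢ (k≢m ∘ cong suc)

-- Below degree k only the constant term is nonzero, since no positive number below k is a multiple
-- of k. From degree k on, k divides k + r exactly when it divides r.
geom-unfold : ∀ k .{{_ : ℕ.NonZero k}} → geom k ≗ (one ⊕ (mono k ⊛ geom k))
geom-unfold k@(suc _) m with m ℕ.<? k
geom-unfold k@(suc _) zero | yes m<k
  rewrite dec-true (k ∣? 0) (k ∣0) = ≡.refl
geom-unfold k@(suc _) (suc m) | yes m<k
  rewrite dec-false (k ∣? suc m) (>⇒∤ m<k) = ≡.sym (mono-⊛-< (geom k) m<k)
geom-unfold k@(suc k′) m | no m≮k with ℕ.m≤n⇒∃[o]m+o≡n (ℕ.≮⇒≥ m≮k)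
... | r , ≡.refl = begin
  geom k (k ℕ.+ r)
    ≡⟨ cong (if_then 1 else 0)
         (does-⇔ (mk⇔ (λ k∣k+r → ∣m+n∣m⇒∣n k∣k+r ∣-refl) (∣m∣n⇒∣m+n ∣-refl))
                 (k ∣? (k ℕ.+ r)) (k ∣? r)) ⟩
  geom k r
    ≡⟨ mono-⊛-+ k (geom k) r ⟨
  (mono k ⊛ geom k) (k ℕ.+ r) ∎
  where open ≡.≡-Reasoning

-- Parities and the truncated series ring over 𝔽₂.

parity-+-cong : ∀ {a b c d} → parity a ≡ parity b → parity c ≡ parity d →
                parity (a ℕ.+ c) ≡ parity (b ℕ.+ d)
parity-+-cong {a} {b} {c} {d} p q =
  ≡.trans (ℙ.+-homo-+ a c) (≡.trans (cong₂ ℙ._+_ p q) (≡.sym (ℙ.+-homo-+ b d)))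

parity-*-cong : ∀ {a b c d} → parity a ≡ parity b → parity c ≡ parity d →
                parity (a ℕ.* c) ≡ parity (b ℕ.* d)
parity-*-cong {a} {b} {c} {d} p q =
  ≡.trans (ℙ.*-homo-* a c) (≡.trans (cong₂ ℙ._*_ p q) (≡.sym (ℙ.*-homo-* b d)))

parity-sumUpTo-cong : ∀ n {f g} → (∀ i → i ≤ n → parity (f i) ≡ parity (g i)) →
                      parity (sumUpTo n f) ≡ parity (sumUpTo n g)
parity-sumUpTo-cong =
  sumUpTo-preserves (λ x y → parity x ≡ parity y)
                    (λ {a} {b} {c} {d} → parity-+-cong {a} {b} {c} {d})

module _ (N : ℕ) where

  infix 4 _≡₂_

  -- Equality in 𝔽₂[q] / (q^(N+1)).
  record _≡₂_ (f g : Series) : Set where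
    constructor congruent
    field coeff : ∀ m → m ≤ N → parity (f m) ≡ parity (g m)

  open _≡₂_ public

  ≗⇒≡₂ : ∀ {f g} → f ≗ g → f ≡₂ g
  ≗⇒≡₂ f≗g = congruent (λ m _ → cong parity (f≗g m))

  series : CommutativeSemiring _ _
  series = record
    { Carrier = Series
    ; _≈_     = _≡₂_
    ; _+_     = _⊕_
    ; _*_     = _⊛_
    ; 0#      = 𝟘
    ; 1#      = one
    ; isCommutativeSemiring = isCommutativeSemiringˡ (record
        { +-isCommutativeMonoid = isCommutativeMonoidˡ (record
            { isSemigroup = record
                { isMagma = record { isEquivalence = isEquivalence ; ∙-cong = ⊕-cong }
                ; assoc   = λ f g h → ≗⇒≡₂ (λ m → ℕ.+-assoc (f m) (g m) (h m))
                }
            ; identityˡ = λ _ → ≗⇒≡₂ (λ _ → ≡.refl)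
            ; comm      = λ f g → ≗⇒≡₂ (λ m → ℕ.+-comm (f m) (g m))
            })
        ; *-isCommutativeMonoid = isCommutativeMonoidˡ (record
            { isSemigroup = record
                { isMagma = record { isEquivalence = isEquivalence ; ∙-cong = ⊛-cong }
                ; assoc   = λ f g h → ≗⇒≡₂ (⊛-assoc f g h)
                }
            ; identityˡ = λ f → ≗⇒≡₂ (⊛-identityˡ f)
            ; comm      = λ f g → ≗⇒≡₂ (⊛-comm f g)
            })
        ; distribʳ = λ h f g → ≗⇒≡₂ (⊛-distribʳ h f g)
        ; zeroˡ    = λ f → ≗⇒≡₂ (⊛-zeroˡ f)
        })
    }
    where
    isEquivalence : IsEquivalence _≡₂_
    isEquivalence = record
      { refl  = ≗⇒≡₂ (λ _ → ≡.refl)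
      ; sym   = λ p → congruent (λ m m≤N → ≡.sym (coeff p m m≤N))
      ; trans = λ p q → congruent (λ m m≤N → ≡.trans (coeff p m m≤N) (coeff q m m≤N))
      }

    ⊕-cong : Congruent₂ _≡₂_ _⊕_
    ⊕-cong {f} {f′} {g} {g′} p q = congruent (λ m m≤N →
      parity-+-cong {f m} {f′ m} {g m} {g′ m} (coeff p m m≤N) (coeff q m m≤N))

    -- The coefficient of q^m in a product involves only coefficients of index at most m, so
    -- agreement up to N suffices.
    ⊛-cong : Congruent₂ _≡₂_ _⊛_
    ⊛-cong {f} {f′} {g} {g′} p q = congruent (λ m m≤N → parity-sumUpTo-cong m (λ i i≤m →
      parity-*-cong {f i} {f′ i} {g (m ∸ i)} {g′ (m ∸ i)}
        (coeff p i (ℕ.≤-trans i≤m m≤N))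
        (coeff q (m ∸ i) (ℕ.≤-trans (ℕ.m∸n≤m m i) m≤N))))

-- The identity ψ²/(f₁f₂) = ψ for concrete series.

module _ (N : ℕ) where

  open CommutativeSemiring (series N)

  series-x+x≈0 : ∀ f → f + f ≈ 0#
  series-x+x≈0 f = congruent (λ m _ → ≡.trans (ℙ.+-homo-+ (f m) (f m)) (ℙ.p+p≡0ℙ (parity (f m))))

  open CharacteristicTwo (series N) series-x+x≈0
  open import Relation.Binary.Reasoning.Setoid setoid

  q : Series
  q = mono 1

  q^≈mono : ∀ k → q ^ k ≈ mono k
  q^≈mono zero    = refl
  q^≈mono (suc k) = begin
    q * q ^ k             ≈⟨ *-congˡ {q} (q^≈mono k) ⟩
    q * mono k            ≈⟨ ≗⇒≡₂ N (shift-⊛ one (mono k)) ⟩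
    shift (one * mono k)  ≈⟨ ≗⇒≡₂ N (λ { zero → ≡.refl ; (suc m) → ⊛-identityˡ (mono k) m }) ⟩
    mono (suc k)          ∎

  q^≈0 : ∀ {k} → N < k → q ^ k ≈ 0#
  q^≈0 {k} N<k = trans (q^≈mono k) (congruent (λ m m≤N →
    cong parity (mono-≢ {k} {m} (λ k≡m → ℕ.<⇒≱ N<k (≡.subst (_≤ N) (≡.sym k≡m) m≤N)))))

  open Truncated q N q^≈0
  open Geometric geom
    (λ k → trans (≗⇒≡₂ N (geom-unfold k)) (+-congˡ {one} (*-congʳ {geom k} (sym (q^≈mono k)))))
    prodGeom (λ _ → refl) (λ _ _ → refl) public
    using (cubic; cubic-stable; cubic-convolution)

  -- `∑` excludes its upper bound while `sumUpTo` includes it, hence `suc n` against n.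
  ∑-coeff : ∀ n f m → ∑ (suc n) f m ≡ sumUpTo n (λ k → f k m)
  ∑-coeff zero    f m = ≡.refl
  ∑-coeff (suc n) f m = cong (ℕ._+ f (suc n) m) (∑-coeff n f m)

  ∑-⊛-coeff : ∀ n f g m → (∑ (suc n) f ⊛ g) m ≡ sumUpTo n (λ k → (f k ⊛ g) m)
  ∑-⊛-coeff zero    f g m = ≡.refl
  ∑-⊛-coeff (suc n) f g m =
    ≡.trans (⊛-distribʳ g (∑ (suc n) f) (f (suc n)) m)
            (cong (ℕ._+ (f (suc n) ⊛ g) m) (∑-⊛-coeff n f g m))

  -- Compares the coefficients of q^N, the highest degree that the truncation retains.
  convolution≡triangular :
    parity (sumUpTo N (λ k → (mono (k ℕ.+ k ℕ.* k) ⊛ cubic N) N))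
      ≡ parity (sumUpTo N (λ k → mono (tri k) N))
  convolution≡triangular = ≡.trans (≡.trans
    (≡.sym (cong parity (∑-⊛-coeff N (λ k → mono (k ℕ.+ k ℕ.* k)) (cubic N) N)))
    (coeff identity N ℕ.≤-refl))
    (cong parity (∑-coeff N (λ k → mono (tri k)) N))
    where
    identity : ∑ (suc N) (λ k → mono (k ℕ.+ k ℕ.* k)) * cubic N ≈ ∑ (suc N) (λ k → mono (tri k))
    identity = begin
      ∑ (suc N) (λ k → mono (k ℕ.+ k ℕ.* k)) * cubic N
        ≈⟨ *-congʳ {cubic N} (∑-cong (suc N) (λ k → q^≈mono (k ℕ.+ k ℕ.* k))) ⟨
      ∑ (suc N) (λ k → q ^ (k ℕ.+ k ℕ.* k)) * cubic N
        ≈⟨ cubic-convolution ⟩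
      ψ q (suc N)
        ≈⟨ ∑-cong (suc N) (λ k → q^≈mono (tri k)) ⟩
      ∑ (suc N) (λ k → mono (tri k)) ∎

-- From series coefficients to the sum over cubic partition numbers.

sumTerm≡convolution : ∀ n k →
  parity (sumTerm n k) ≡ parity ((mono (k ℕ.+ k ℕ.* k) ⊛ cubic n n) n)
sumTerm≡convolution n k = go (j ℕ.≤? n)
  where
  open ≡.≡-Reasoning
  j = k ℕ.+ k ℕ.* k

  go : (j≤?n : Dec (j ≤ n)) →
       parity (if does j≤?n then a (n ∸ j) else 0) ≡ parity ((mono j ⊛ cubic n n) n)
  -- The default 0 agrees with the coefficient of q^n in a multiple of q^j, as j > n.
  go (no  j≰n) = cong parity (≡.sym (mono-⊛-< (cubic n n) (ℕ.≰⇒> j≰n)))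
  go (yes j≤n) = begin
    parity (a m)
      -- `a m` cuts its products off at m, the convolution at n ≥ m; the two agree mod 2 up to
      -- degree m.
      ≡⟨ coeff (cubic-stable m (ℕ.m∸n≤m n j)) m ℕ.≤-refl ⟨
    parity (cubic n n m)
      ≡⟨ cong parity (mono-⊛-+ j (cubic n n) m) ⟨
    parity ((mono j ⊛ cubic n n) (j ℕ.+ m))
      ≡⟨ cong (parity ∘ (mono j ⊛ cubic n n)) (ℕ.m+[n∸m]≡n j≤n) ⟩
    parity ((mono j ⊛ cubic n n) n) ∎
    where m = n ∸ j

-- For f = `sumTerm n` the value f 0 is `a n`, so `lhs n` is the full sum over k from 0.
sumUpTo-split-0 : ∀ n f →
  f 0 ℕ.+ sumUpTo n (λ k → if does (k ℕ.≟ 0) then 0 else f k) ≡ sumUpTo n f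
sumUpTo-split-0 zero    f = ℕ.+-identityʳ (f 0)
sumUpTo-split-0 (suc n) f =
  ≡.trans (≡.sym (ℕ.+-assoc (f 0) _ _)) (cong (ℕ._+ f (suc n)) (sumUpTo-split-0 n f))

lhs≡triangular : ∀ n → parity (lhs n) ≡ parity (sumUpTo n (λ k → mono (tri k) n))
lhs≡triangular n =
  ≡.trans (cong parity (sumUpTo-split-0 n (sumTerm n)))
    (≡.trans (parity-sumUpTo-cong n (λ k _ → sumTerm≡convolution n k))
             (convolution≡triangular n))

-- Sums of powers of q with increasing exponents.

module _ (t : ℕ → ℕ) (t-increasing : ∀ k → t k < t (suc k)) where

  increasing⇒monotone : ∀ {j k} → j ≤′ k → t j ≤ t k
  increasing⇒monotone ≤′-refl       = ℕ.≤-refl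
  increasing⇒monotone (≤′-step j≤k) =
    ℕ.≤-trans (increasing⇒monotone j≤k) (ℕ.<⇒≤ (t-increasing _))

  sumUpTo-mono-≢ : ∀ m n → (∀ k → k ≤ n → t k ≢ m) → sumUpTo n (λ k → mono (t k) m) ≡ 0
  sumUpTo-mono-≢ m n t≢m =
    ≡.trans (sumUpTo-cong n (λ k k≤n → mono-≢ (t≢m k k≤n))) (sumUpTo-0 n)

  sumUpTo-mono-last : ∀ n → sumUpTo n (λ k → mono (t k) (t n)) ≡ 1
  sumUpTo-mono-last zero    = mono-≡ (t 0)
  sumUpTo-mono-last (suc n) = cong₂ ℕ._+_
    (sumUpTo-mono-≢ (t (suc n)) n (λ k k≤n →
      ℕ.<⇒≢ (ℕ.≤-<-trans (increasing⇒monotone (ℕ.≤⇒≤′ k≤n)) (t-increasing n))))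
    (mono-≡ (t (suc n)))

  -- An increasing sequence meets m at most once, so the coefficient of q^m is 0 or 1 as a natural
  -- number, before any reduction mod 2.
  sumUpTo-mono : ∀ m n →
    (∃[ k ] (t k ≡ m × sumUpTo n (λ k → mono (t k) m) ≡ 1))
      ⊎ ((∀ k → k ≤ n → t k ≢ m) × sumUpTo n (λ k → mono (t k) m) ≡ 0)
  sumUpTo-mono m zero with t 0 ℕ.≟ m
  ... | yes ≡.refl = inj₁ (0 , ≡.refl , mono-≡ (t 0))
  ... | no  t0≢m   = inj₂ ((λ { _ ℕ.z≤n → t0≢m }) , mono-≢ t0≢m)
  sumUpTo-mono m (suc n) with t (suc n) ℕ.≟ m | sumUpTo-mono m n
  ... | yes ≡.refl | _ = inj₁ (suc n , ≡.refl , sumUpTo-mono-last (suc n))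
  ... | no  t≢m | inj₁ (k , tk≡m , sum≡1) =
    inj₁ (k , tk≡m , cong₂ ℕ._+_ sum≡1 (mono-≢ t≢m))
  ... | no  t≢m | inj₂ (below , sum≡0) =
    inj₂ (all , cong₂ ℕ._+_ sum≡0 (mono-≢ t≢m))
    where
    all : ∀ k → k ≤ suc n → t k ≢ m
    all k k≤1+n with ℕ.m≤n⇒m<n∨m≡n k≤1+n
    ... | inj₁ (ℕ.s≤s k≤n) = below k k≤n
    ... | inj₂ ≡.refl      = t≢m

-- From parities to remainders, and the congruence itself.

parity⇒%2 : ∀ {m n} → parity m ≡ parity n → m % 2 ≡ n % 2
parity⇒%2 {zero}        {zero}        _ = ≡.refl
parity⇒%2 {suc zero}    {suc zero}    _ = ≡.refl
parity⇒%2 {suc (suc m)} {n}           p = parity⇒%2 {m} {n} p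
parity⇒%2 {zero}        {suc (suc n)} p = parity⇒%2 {zero} {n} p
parity⇒%2 {suc zero}    {suc (suc n)} p = parity⇒%2 {suc zero} {n} p

theorem4p1 : (n : ℕ) → (IsTriangular n × lhs n % 2 ≡ 1) ⊎ (¬ IsTriangular n × lhs n % 2 ≡ 0)
theorem4p1 n with sumUpTo-mono tri (λ k → ℕ.s≤s (ℕ.m≤n+m (tri k) k)) n n
... | inj₁ (k , ≡.refl , sum≡1) =
  inj₁ ((k , 2*tri k) , parity⇒%2 {lhs n} {1} (≡.trans (lhs≡triangular n) (cong parity sum≡1)))
... | inj₂ (t≢n , sum≡0) =
  inj₂ ((λ { (s , 2n≡s[s+1]) →
              let tri≡n = ℕ.*-cancelˡ-≡ (tri s) n 2 (≡.trans (2*tri s) (≡.sym 2n≡s[s+1]))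
              -- The bound s ≤ `tri s` = n puts s among the indices that the sum has already
              -- excluded.
              in t≢n s (≡.subst (s ≤_) tri≡n (n≤tri s)) tri≡n })
       , parity⇒%2 {lhs n} {0} (≡.trans (lhs≡triangular n) (cong parity sum≡0)))
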